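{- For every integer $k\ge 1$ there is a constant $c_k$ such that for every oriented tree $T$, $$\mathrm{RT}(T,k)\le c_k|T|^k.$$
   Context: An oriented graph is a directed graph with no loops and at most one edge between any two vertices. An oriented tree is an oriented graph whose underlying undirected graph is a tree; $|T|$ denotes its number of vertices. A tournament is an oriented graph with exactly one edge between every pair of distinct vertices. A $k$-colouring means an edge-colouring with colours $\{1,\dots,k\}$. A copy of $H$ is a (not necessarily induced) subgraph isomorphic to $H$ as a directed graph. The $k$-colour oriented Ramsey number $\mathrm{RT}(H,k)$ of an oriented graph $H$ is the least integer $n$ such that every $k$-coloured tournament on $n$ vertices contains a monochromatic copy of $H$. -}

module Defs where

open import Data.Bool.Base using (Bool; T)
open import Data.Fin.Base using (Fin; zero; suc; inject₁; fromℕ)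
open import Data.Nat.Base using (ℕ; _+_; _≤_; NonZero)
open import Data.Product.Base using (∃; _×_)
open import Data.Sum.Base using (_⊎_)
open import Function.Definitions using (Injective)
open import Level using (0ℓ)
open import Relation.Binary.Construct.Closure.ReflexiveTransitive using (Star)
open import Relation.Binary.Construct.Closure.Symmetric using (SymClosure)
open import Relation.Binary.Core using (Rel)
open import Relation.Binary.Definitions using (Irreflexive; Asymmetric)
open import Relation.Binary.PropositionalEquality.Core using (_≡_; _≢_)
open import Relation.Nullary.Negation.Core using (¬_)

-- The adjacency matrix is Boolean so that u ⟶ v has at most one proof:
-- there are no parallel edges, and a function on the proofs of u ⟶ v
-- assigns a single value to the edge.
record OrientedGraph (n : ℕ) : Set where
  infix 4 _⟶_
  field
    adjacent : Fin n → Fin n → Bool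

  _⟶_ : Rel (Fin n) 0ℓ
  u ⟶ v = T (adjacent u v)

  field
    irrefl : Irreflexive _≡_ _⟶_
    asym   : Asymmetric _⟶_

module _ {n : ℕ} (_~_ : Rel (Fin n) 0ℓ) where

  Connected : Set
  Connected = ∀ u v → Star _~_ u v

  -- Cycles have length 3 + l, so traversing one edge back and forth is
  -- not a cycle.
  record Cycle : Set where
    field
      {l}      : ℕ
      vertex   : Fin (3 + l) → Fin n
      distinct : Injective _≡_ _≡_ vertex
      step     : ∀ i → vertex (inject₁ i) ~ vertex (suc i)
      close    : vertex (fromℕ (2 + l)) ~ vertex zero

  record IsTree : Set where
    field
      nonEmpty  : NonZero n
      connected : Connected
      acyclic   : ¬ Cycle

record OrientedTree (n : ℕ) : Set where
  field
    graph : OrientedGraph n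
  open OrientedGraph graph public
  field
    isTree : IsTree (SymClosure _⟶_)

record Tournament (n : ℕ) : Set where
  field
    graph : OrientedGraph n
  open OrientedGraph graph public
  field
    -- Together with asym: exactly one of the two edges is present.
    total : ∀ {u v} → u ≢ v → u ⟶ v ⊎ v ⟶ u

Colouring : ∀ {n} → OrientedGraph n → ℕ → Set
Colouring G k = ∀ u v → u ⟶ v → Fin k
  where open OrientedGraph G

record Copy {m n} (H : OrientedGraph m) (G : OrientedGraph n) : Set where
  private
    module H = OrientedGraph H
    module G = OrientedGraph G
  field
    embed     : Fin m → Fin n
    injective : Injective _≡_ _≡_ embed
    edge      : ∀ u v → u H.⟶ v → embed u G.⟶ embed v

Monochromatic : ∀ {m n k} {H : OrientedGraph m} {G : OrientedGraph n} →
                Colouring G k → Copy H G → Set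
Monochromatic {k = k} {H = H} colour copy =
  ∃ λ (c : Fin k) → ∀ u v (e : u ⟶ v) →
    colour (embed u) (embed v) (edge u v e) ≡ c
  where
  open OrientedGraph H
  open Copy copy

Unavoidable : ∀ {m} → OrientedGraph m → ℕ → ℕ → Set
Unavoidable H k n =
  (G : Tournament n) (colour : Colouring (Tournament.graph G) k) →
  ∃ λ (copy : Copy H (Tournament.graph G)) → Monochromatic colour copy

IsLeast : (ℕ → Set) → ℕ → Set
IsLeast P n = P n × (∀ m → P m → n ≤ m)

-- RT(H,k) = r.  This is a relation rather than a function because such an r
-- need not exist: for k ≥ 1 there is none if H contains a directed cycle.
IsRT : ∀ {m} → OrientedGraph m → ℕ → ℕ → Set
IsRT H k r = IsLeast (Unavoidable H k) r

{-# OPTIONS --safe #-}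

-- The core is a one-colour statement: a loopless digraph on more than 20 n a
-- vertices without independent sets of size > a contains every oriented tree
-- on n vertices.  Applied to one colour class at a time it gives, by induction
-- on the number of colours, N ≤ (20 n) ^ k for a tournament without
-- monochromatic copies.
--
-- For any vertex weights some independent set I captures half of the weight in
-- I ∪ N⁻(I): repeatedly take a vertex whose in-weight is at least its
-- out-weight and delete its neighbours.  By multiplicative weights there is
-- then a fractional kernel: a probability distribution on independent sets
-- that hits the closed out-neighbourhood of every vertex with probability ≥ 1/5.
-- Stack 2 n stages, each consisting of one such kernel for out- and one for
-- in-neighbours, and after each stage discard the vertices whose accumulated
-- kernel weight exceeds 1/5; few are lost.  A surviving vertex is dominated by
-- all earlier stages.  Embed the tree from its root outwards, one stage at a
-- time from the last to the first.  A stage has an unused neighbour for the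
-- next vertex unless it puts weight ≥ 1/5 on the vertices used so far, and
-- since each used vertex has small accumulated weight there are few such stages.

module Submission where

open import Data.Bool.Base using (Bool; true; false; T; _∧_; _∨_; not; if_then_else_)
open import Data.Bool.Properties using (T?; T-∧; T-∨)
open import Data.Empty using (⊥-elim)
open import Data.Fin.Base using (Fin; zero; suc; inject₁; fromℕ; toℕ; fromℕ<; finToFun; funToFin)
open import Data.Fin.Properties
  using (_≟_; any?; all?; injective⇒≤; suc-injective; toℕ-injective; toℕ-fromℕ<; toℕ≤pred[n]; finToFun-funToFin)
open import Data.List.Base using (List; []; _∷_; _++_; [_]; length; lookup; map)
import Data.List.Membership.DecPropositional as DecMembership
open import Data.List.Membership.Propositional using (_∈_; _∉_)
open import Data.List.Membership.Propositional.Properties using (∈-++⁻; ∈-lookup; ∈-map⁺; ∈-map⁻)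
open import Data.List.Relation.Unary.All as All using (All; []; _∷_)
open import Data.List.Relation.Unary.All.Properties using (¬Any⇒All¬)
open import Data.List.Relation.Unary.AllPairs using ([]; _∷_)
open import Data.List.Relation.Unary.Any using (here; there)
open import Data.List.Relation.Unary.Unique.Propositional using (Unique)
open import Data.List.Relation.Unary.Unique.Propositional.Properties using (++⁺)
open import Data.Nat.Base
open import Data.Nat.Properties hiding (_≟_; suc-injective)
open import Data.Nat.Tactic.RingSolver using (solve-∀)
open import Data.Product.Base using (∃; ∃₂; _×_; _,_; proj₁; proj₂)
open import Data.Sum.Base using (_⊎_; inj₁; inj₂; [_,_]′)
open import Data.Unit.Base using (tt)
open import Function.Base using (_∘_; const)
open import Function.Bundles using (Equivalence)
open import Function.Definitions using (Injective)
open import Level using (0ℓ)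
open import Relation.Binary.Construct.Closure.ReflexiveTransitive using (Star; ε; _◅_)
open import Relation.Binary.Construct.Closure.Symmetric using (SymClosure; fwd; bwd; symmetric)
open import Relation.Binary.Core using (Rel)
open import Relation.Binary.Definitions using (Symmetric)
open import Relation.Binary.PropositionalEquality hiding ([_])
open import Relation.Nullary using (Dec; ¬_; yes; no; contradiction; does)
open import Relation.Nullary.Decidable
  using (_×-dec_; _→-dec_; _⊎-dec_; ⌊_⌋; toWitness; fromWitness; ¬?; map′; decidable-stable)
open import Relation.Unary using (Decidable)
open import Algebra.Properties.Semiring.Sum +-*-semiring
  using (sum; sum-cong-≗; ∑-distrib-+; ∑-comm; sum-replicate-zero; *-distribˡ-sum)
open import Defs

-- Powers, and sums over finite index sets.

^-distribʳ-* : ∀ x y e → (x * y) ^ e ≡ x ^ e * y ^ e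
^-distribʳ-* x y zero    = refl
^-distribʳ-* x y (suc e) = trans (cong (x * y *_) (^-distribʳ-* x y e)) (shuffle x y (x ^ e) (y ^ e))
  where
  shuffle : ∀ x y z w → x * y * (z * w) ≡ x * z * (y * w)
  shuffle = solve-∀

sum-mono-≤ : ∀ {n} {f g : Fin n → ℕ} → (∀ i → f i ≤ g i) → sum f ≤ sum g
sum-mono-≤ {zero}  f≤g = z≤n
sum-mono-≤ {suc n} f≤g = +-mono-≤ (f≤g zero) (sum-mono-≤ (f≤g ∘ suc))

sum-mono-< : ∀ {n} {f g : Fin n → ℕ} → (∀ i → f i ≤ g i) →
             ∀ j → f j < g j → sum f < sum g
sum-mono-< f≤g zero    f<g = +-mono-<-≤ f<g (sum-mono-≤ (f≤g ∘ suc))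
sum-mono-< f≤g (suc j) f<g = +-mono-≤-< (f≤g zero) (sum-mono-< (f≤g ∘ suc) j f<g)

term≤sum : ∀ {n} (f : Fin n → ℕ) i → f i ≤ sum f
term≤sum f zero    = m≤m+n _ _
term≤sum f (suc i) = ≤-trans (term≤sum (f ∘ suc) i) (m≤n+m _ _)

sum-replicate-1 : ∀ n → sum {n} (const 1) ≡ n
sum-replicate-1 zero    = refl
sum-replicate-1 (suc n) = cong suc (sum-replicate-1 n)

𝟙 : Bool → ℕ
𝟙 b = if b then 1 else 0

𝟙-true : ∀ {b} → T b → 𝟙 b ≡ 1
𝟙-true {true} _ = refl

-- Independent sets dominating half of a weight.

module _ {N : ℕ} where

  weight : (Fin N → Bool) → (Fin N → ℕ) → ℕ
  weight A h = sum λ v → 𝟙 (A v) * h v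

  size : (Fin N → Bool) → ℕ
  size A = weight A (const 1)

  weight-∅ : ∀ h → weight (const false) h ≡ 0
  weight-∅ h = sum-replicate-zero N

  size-∅ : ∀ W → (∀ v → ¬ T (W v)) → size W ≡ 0
  size-∅ W empty = trans (sum-cong-≗ vanish) (sum-replicate-zero N)
    where
    vanish : ∀ v → 𝟙 (W v) * 1 ≡ 0
    vanish v with W v | empty v
    ... | true  | absurd = contradiction tt absurd
    ... | false | _      = refl

  module _ (R : Fin N → Fin N → Bool) where

    -- `R` will be the reflexive closure of an edge relation, or its converse. Hence independence
    -- reads `R u v → u ≡ v`, and a vertex of `I` may dominate itself. `C` is carried as data
    -- because the recursion adds up its weight piece by piece.
    record Dominating (W : Fin N → Bool) (h : Fin N → ℕ) : Set where
      field
        I C         : Fin N → Bool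
        I⊆W         : ∀ v → T (I v) → T (W v)
        C⊆W         : ∀ v → T (C v) → T (W v)
        independent : ∀ u v → T (I u) → T (I v) → T (R u v) → u ≡ v
        dominated   : ∀ v → T (C v) → ∃ λ u → T (I u) × T (R v u)
        half        : weight W h ≤ 2 * weight C h

    private
      module _ (W : Fin N → Bool) (h : Fin N → ℕ) where
        w inw out : Fin N → ℕ
        w v = 𝟙 (W v) * h v
        inw v = sum λ u → w u * 𝟙 (R u v)
        out v = sum λ u → w u * 𝟙 (R v u)

        -- Both sides count the pairs with `R u v`, each weighted by `w u * w v`.
        in-out-balance : sum (λ v → w v * inw v) ≡ sum (λ v → w v * out v)
        in-out-balance = begin
          sum (λ v → w v * inw v)
            ≡⟨ sum-cong-≗ (λ v → *-distribˡ-sum (w v) (λ u → w u * 𝟙 (R u v))) ⟩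
          sum (λ v → sum λ u → w v * (w u * 𝟙 (R u v)))
            ≡⟨ ∑-comm (λ v u → w v * (w u * 𝟙 (R u v))) ⟩
          sum (λ u → sum λ v → w v * (w u * 𝟙 (R u v)))
            ≡⟨ sum-cong-≗ (λ u → sum-cong-≗ λ v → swap (w v) (w u) (𝟙 (R u v))) ⟩
          sum (λ u → sum λ v → w u * (w v * 𝟙 (R u v)))
            ≡⟨ sum-cong-≗ (λ u → sym (*-distribˡ-sum (w u) (λ v → w v * 𝟙 (R u v)))) ⟩
          sum (λ v → w v * out v) ∎
          where
          open ≡-Reasoning
          swap : ∀ a b c → a * (b * c) ≡ b * (a * c)
          swap = solve-∀

        -- If out-weight exceeded in-weight by at least one throughout `W`, averaging against `w`
        -- would put the two sides of `in-out-balance` apart by at least the weight of `W`.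
        sink-heavy : ¬ (∃ λ v → T (W v) × out v ≤ inw v) → weight W h ≡ 0
        sink-heavy none = n≤0⇒n≡0 (+-cancelʳ-≤ (sum λ v → w v * inw v) _ _ (begin
          sum w + sum (λ v → w v * inw v)   ≡⟨ ∑-distrib-+ w _ ⟨
          sum (λ v → w v + w v * inw v)     ≤⟨ sum-mono-≤ pointwise ⟩
          sum (λ v → w v * out v)           ≡⟨ in-out-balance ⟨
          sum (λ v → w v * inw v)           ∎))
          where
          open ≤-Reasoning
          pointwise : ∀ v → w v + w v * inw v ≤ w v * out v
          pointwise v with W v in eq
          ... | false = z≤n
          ... | true  = begin
            x + x * inw v   ≡⟨ *-suc x (inw v) ⟨
            x * suc (inw v) ≤⟨ *-monoʳ-≤ x (≰⇒> λ o≤i → none (v , subst T (sym eq) tt , o≤i)) ⟩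
            x * out v       ∎
            where x = h v + 0

    -- Fractional kernels by multiplicative weights.

    nbhd : (Fin N → ℕ) → Fin N → ℕ
    nbhd c v = sum λ u → 𝟙 (R v u) * c u

    Independent : (W I : Fin N → Bool) → Set
    Independent W I = (∀ v → T (I v) → T (W v)) × (∀ u v → T (I u) → T (I v) → T (R u v) → u ≡ v)

    module _ (W : Fin N → Bool) (a : ℕ) where

      -- The state after `q` rounds: `c v` counts the chosen independent sets containing `v`, and
      -- `h` holds the current weights. `covered` says that `h v` is at least 2 to the power `q`
      -- minus `nbhd c v`, and `potential` that the total weight is at most (3/2)^q N; both are
      -- cleared of subtraction and division.
      record Rounds (q : ℕ) : Set where
        field
          c h       : Fin N → ℕ
          support   : ∀ v → 0 < c v → T (W v)
          total     : sum c ≤ q * a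
          covered   : ∀ v → T (W v) → 2 ^ q ≤ h v * 2 ^ nbhd c v
          potential : 2 ^ q * weight W h ≤ 3 ^ q * N

      -- Only the vertex marginals of the distribution on independent sets are kept, scaled by `q`
      -- to be natural numbers.
      record FractionalKernel (q : ℕ) : Set where
        field
          c         : Fin N → ℕ
          support   : ∀ v → 0 < c v → T (W v)
          total     : sum c ≤ q * a
          dominated : ∀ v → T (W v) → q ≤ 5 * nbhd c v

    module _ (R-refl : ∀ v → T (R v v)) where

      -- Adding `v` to the independent set costs the weight of its in- and out-neighbours, at most
      -- `2 * inw W h v` by the choice of `v`, while all its in-neighbours become dominated. The
      -- recursion treats the rest, with `f` as fuel.
      dominating : ∀ f W h → size W ≤ f → Dominating W h
      dominating f W h W≤f with any? (λ v → T? (W v) ×-dec (out W h v ≤? inw W h v))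
      ... | no none = record
        { I = const false ; C = const false
        ; I⊆W = λ _ () ; C⊆W = λ _ () ; independent = λ _ _ () ; dominated = λ _ ()
        ; half = ≤-reflexive (trans (sink-heavy W h none) (sym (cong (2 *_) (weight-∅ h))))
        }
      dominating zero W h W≤f | yes (v , Wv , _) = contradiction
        (≤-trans (≤-reflexive (sym (trans (*-identityʳ _) (𝟙-true Wv))))
          (≤-trans (term≤sum (λ u → 𝟙 (W u) * 1) v) W≤f)) λ ()
      dominating (suc f) W h W≤f | yes (v , Wv , out≤in) = record
        { I = I ; C = C
        ; I⊆W = I⊆W
        ; C⊆W = C⊆W
        ; independent = indep
        ; dominated = dom
        ; half = half
        }
        where
        -- By reflexivity `v` itself is deleted, so the size drops. No remaining vertex is related
        -- to `v` in either direction, which keeps the enlarged set independent.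
        W′ : Fin N → Bool
        W′ u = W u ∧ (not (R u v) ∧ not (R v u))
        W′⊆W : ∀ u → T (W′ u) → T (W u) × ¬ T (R u v) × ¬ T (R v u)
        W′⊆W u p with W u | R u v | R v u
        ... | true | false | false = tt , (λ ()) , λ ()
        shrink : size W′ ≤ f
        shrink = s≤s⁻¹ (≤-trans (sum-mono-< le v lt) W≤f)
          where
          le : ∀ u → 𝟙 (W′ u) * 1 ≤ 𝟙 (W u) * 1
          le u with W u | not (R u v) ∧ not (R v u)
          ... | true  | true  = ≤-refl
          ... | true  | false = z≤n
          ... | false | _     = z≤n
          lt : 𝟙 (W′ v) * 1 < 𝟙 (W v) * 1
          lt = subst₂ _<_ (sym v∉W′) (sym (trans (*-identityʳ _) (𝟙-true Wv))) (s≤s z≤n)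
            where
            v∉W′ : 𝟙 (W′ v) * 1 ≡ 0
            v∉W′ with W v | R v v | R-refl v
            ... | true  | true | _ = refl
            ... | false | true | _ = refl
        module D = Dominating (dominating f W′ h shrink)
        I C : Fin N → Bool
        I u = D.I u ∨ ⌊ u ≟ v ⌋
        C u = D.C u ∨ (W u ∧ R u v)
        I-cases : ∀ u → T (I u) → T (D.I u) ⊎ u ≡ v
        I-cases u p with Equivalence.to T-∨ p
        ... | inj₁ q = inj₁ q
        ... | inj₂ q = inj₂ (toWitness q)
        I⊆W : ∀ u → T (I u) → T (W u)
        I⊆W u p with I-cases u p
        ... | inj₁ q    = proj₁ (W′⊆W u (D.I⊆W u q))
        ... | inj₂ refl = Wv
        C⊆W : ∀ u → T (C u) → T (W u)
        C⊆W u p with Equivalence.to T-∨ p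
        ... | inj₁ q = proj₁ (W′⊆W u (D.C⊆W u q))
        ... | inj₂ q = proj₁ (Equivalence.to T-∧ q)
        indep : ∀ x y → T (I x) → T (I y) → T (R x y) → x ≡ y
        indep x y p q r with I-cases x p | I-cases y q
        ... | inj₁ p′   | inj₁ q′   = D.independent x y p′ q′ r
        ... | inj₁ p′   | inj₂ refl = contradiction r (proj₁ (proj₂ (W′⊆W x (D.I⊆W x p′))))
        ... | inj₂ refl | inj₁ q′   = contradiction r (proj₂ (proj₂ (W′⊆W y (D.I⊆W y q′))))
        ... | inj₂ refl | inj₂ refl = refl
        dom : ∀ x → T (C x) → ∃ λ u → T (I u) × T (R x u)
        dom x p with Equivalence.to T-∨ p
        ... | inj₁ q = let u , Iu , Rxu = D.dominated x q
                       in u , Equivalence.from T-∨ (inj₁ Iu) , Rxu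
        ... | inj₂ q = v , Equivalence.from (T-∨ {D.I v}) (inj₂ (fromWitness {a? = v ≟ v} refl)) ,
                       proj₂ (Equivalence.to T-∧ q)
        split : weight W h ≤ weight W′ h + (inw W h v + out W h v)
        split = begin
          weight W h ≤⟨ sum-mono-≤ pointwise ⟩
          sum (λ u → 𝟙 (W′ u) * h u + (w W h u * 𝟙 (R u v) + w W h u * 𝟙 (R v u)))
            ≡⟨ ∑-distrib-+ (λ u → 𝟙 (W′ u) * h u) _ ⟩
          weight W′ h + sum (λ u → w W h u * 𝟙 (R u v) + w W h u * 𝟙 (R v u))
            ≡⟨ cong (weight W′ h +_) (∑-distrib-+ (λ u → w W h u * 𝟙 (R u v)) _) ⟩
          weight W′ h + (inw W h v + out W h v) ∎
          where
          open ≤-Reasoning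
          pointwise : ∀ u → w W h u ≤ 𝟙 (W′ u) * h u + (w W h u * 𝟙 (R u v) + w W h u * 𝟙 (R v u))
          pointwise u with W u | R u v | R v u
          ... | false | _     | _     = z≤n
          ... | true  | false | false = m≤m+n _ _
          ... | true  | true  | b     = ≤-trans (≤-reflexive (sym (*-identityʳ _))) (m≤m+n _ _)
          ... | true  | false | true  = ≤-trans (≤-reflexive (sym (*-identityʳ _)))
                                          (m≤n+m ((h u + 0) * 1) ((h u + 0) * 0))
        -- No weight is counted twice: `D.C` lies in `W′`, which contains no in-neighbour of `v`.
        C-large : weight D.C h + inw W h v ≤ weight C h
        C-large = begin
          weight D.C h + inw W h v ≡⟨ ∑-distrib-+ (λ u → 𝟙 (D.C u) * h u) _ ⟨
          sum (λ u → 𝟙 (D.C u) * h u + w W h u * 𝟙 (R u v)) ≤⟨ sum-mono-≤ pointwise ⟩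
          weight C h ∎
          where
          open ≤-Reasoning
          pointwise : ∀ u → 𝟙 (D.C u) * h u + w W h u * 𝟙 (R u v) ≤ 𝟙 (C u) * h u
          pointwise u with D.C u in eqC | W u | R u v in eqR
          ... | false | false | _     = z≤n
          ... | false | true  | true  = ≤-reflexive (*-identityʳ _)
          ... | false | true  | false = ≤-reflexive (*-zeroʳ (h u + 0))
          ... | true  | false | _     = ≤-reflexive (+-identityʳ _)
          ... | true  | true  | false = ≤-reflexive (trans (cong (h u + 0 +_) (*-zeroʳ (h u + 0))) (+-identityʳ _))
          ... | true  | true  | true  = contradiction (subst T (sym eqR) tt)
                  (proj₁ (proj₂ (W′⊆W u (D.C⊆W u (subst T (sym eqC) tt)))))
        half : weight W h ≤ 2 * weight C h
        half = begin
          weight W h                                       ≤⟨ split ⟩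
          weight W′ h + (inw W h v + out W h v)            ≤⟨ +-mono-≤ D.half (+-monoʳ-≤ (inw W h v) out≤in) ⟩
          2 * weight D.C h + (inw W h v + inw W h v)       ≡⟨ lem (weight D.C h) (inw W h v) ⟩
          2 * (weight D.C h + inw W h v)                   ≤⟨ *-monoʳ-≤ 2 C-large ⟩
          2 * weight C h                                   ∎
          where
          open ≤-Reasoning
          lem : ∀ a b → 2 * a + (b + b) ≡ 2 * (a + b)
          lem = solve-∀

      module _ {W a} (small : ∀ I → Independent W I → size I ≤ a) where

        rounds : ∀ q → Rounds W a q
        rounds zero = record
          { c = const 0 ; h = const 1
          ; support = λ _ ()
          ; total = ≤-reflexive (sum-replicate-zero N)
          ; covered = λ v _ → *-monoʳ-≤ 1 (m^n>0 2 (nbhd (const 0) v))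
          ; potential = begin
              1 * weight W (const 1) ≡⟨ *-identityˡ _ ⟩
              weight W (const 1)     ≤⟨ sum-mono-≤ (λ v → 𝟙≤1 (W v)) ⟩
              sum {N} (const 1)      ≡⟨ sum-replicate-1 N ⟩
              N                      ≡⟨ *-identityˡ N ⟨
              1 * N                  ∎
          }
          where
          open ≤-Reasoning
          𝟙≤1 : ∀ b → 𝟙 b * 1 ≤ 1
          𝟙≤1 true  = ≤-refl
          𝟙≤1 false = z≤n
        rounds (suc q) = record
          { c = c′ ; h = h′
          ; support = support′
          ; total = total′
          ; covered = covered′
          ; potential = potential′
          }
          where
          open Rounds (rounds q)
          open Dominating (dominating (size W) W h ≤-refl)
          open ≤-Reasoning
          c′ h′ : Fin N → ℕ
          c′ v = c v + 𝟙 (I v)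
          -- A round multiplies `h v * 2 ^ nbhd c v` by at least 2 on `W`: a vertex of `C` gains in
          -- the exponent, any other vertex in its weight.
          h′ v = if C v then h v else 2 * h v
          support′ : ∀ v → 0 < c′ v → T (W v)
          support′ v 0<c′ with I v | I⊆W v
          ... | true  | Iv⇒Wv = Iv⇒Wv tt
          ... | false | _     = support v (subst (0 <_) (+-identityʳ (c v)) 0<c′)
          total′ : sum c′ ≤ suc q * a
          total′ = begin
            sum c′                  ≡⟨ ∑-distrib-+ c (𝟙 ∘ I) ⟩
            sum c + sum (𝟙 ∘ I)     ≡⟨ cong (sum c +_) (sum-cong-≗ λ v → sym (*-identityʳ (𝟙 (I v)))) ⟩
            sum c + size I          ≤⟨ +-mono-≤ total (small I (I⊆W , independent)) ⟩
            q * a + a               ≡⟨ +-comm (q * a) a ⟩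
            a + q * a               ∎
          nbhd′ : ∀ v → nbhd c′ v ≡ nbhd c v + nbhd (𝟙 ∘ I) v
          nbhd′ v = trans (sum-cong-≗ λ u → *-distribˡ-+ (𝟙 (R v u)) (c u) (𝟙 (I u)))
                          (∑-distrib-+ (λ u → 𝟙 (R v u) * c u) _)
          covered′ : ∀ v → T (W v) → 2 ^ suc q ≤ h′ v * 2 ^ nbhd c′ v
          covered′ v Wv with C v | dominated v
          ... | false | _ = begin
            2 * 2 ^ q                  ≤⟨ *-monoʳ-≤ 2 (covered v Wv) ⟩
            2 * (h v * 2 ^ nbhd c v)   ≡⟨ *-assoc 2 (h v) _ ⟨
            2 * h v * 2 ^ nbhd c v     ≤⟨ *-monoʳ-≤ (2 * h v) (^-monoʳ-≤ 2
                                            (≤-trans (m≤m+n (nbhd c v) _) (≤-reflexive (sym (nbhd′ v))))) ⟩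
            2 * h v * 2 ^ nbhd c′ v    ∎
          ... | true | dom with dom tt
          ... | u , Iu , Rvu = begin
            2 * 2 ^ q                  ≤⟨ *-monoʳ-≤ 2 (covered v Wv) ⟩
            2 * (h v * 2 ^ nbhd c v)   ≡⟨ swap 2 (h v) _ ⟩
            h v * 2 ^ suc (nbhd c v)   ≤⟨ *-monoʳ-≤ (h v) (^-monoʳ-≤ 2 more) ⟩
            h v * 2 ^ nbhd c′ v        ∎
            where
            swap : ∀ x y z → x * (y * z) ≡ y * (x * z)
            swap = solve-∀
            more : suc (nbhd c v) ≤ nbhd c′ v
            more = begin
              suc (nbhd c v)            ≡⟨ +-comm 1 (nbhd c v) ⟩
              nbhd c v + 1              ≡⟨ cong (nbhd c v +_) (cong₂ _*_ (𝟙-true Rvu) (𝟙-true Iu)) ⟨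
              nbhd c v + 𝟙 (R v u) * 𝟙 (I u)
                ≤⟨ +-monoʳ-≤ (nbhd c v) (term≤sum (λ u → 𝟙 (R v u) * 𝟙 (I u)) u) ⟩
              nbhd c v + nbhd (𝟙 ∘ I) v ≡⟨ nbhd′ v ⟨
              nbhd c′ v                 ∎
          doubled : weight W h′ + weight C h ≡ 2 * weight W h
          doubled = trans (sym (∑-distrib-+ (λ v → 𝟙 (W v) * h′ v) _))
            (trans (sum-cong-≗ pointwise) (sym (*-distribˡ-sum 2 (λ v → 𝟙 (W v) * h v))))
            where
            pointwise : ∀ v → 𝟙 (W v) * h′ v + 𝟙 (C v) * h v ≡ 2 * (𝟙 (W v) * h v)
            pointwise v with W v | C v | C⊆W v
            ... | true  | true  | _ = two (h v)
              where
              two : ∀ x → x + 0 + (x + 0) ≡ 2 * (x + 0)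
              two = solve-∀
            ... | true  | false | _ = two (h v)
              where
              two : ∀ x → 2 * x + 0 + 0 ≡ 2 * (x + 0)
              two = solve-∀
            ... | false | false | _ = refl
            ... | false | true  | absurd = ⊥-elim (absurd tt)
          -- At least half of the weight sits on `C` and is kept, and only the rest doubles, so the
          -- total grows by a factor of at most 3/2.
          decay : 2 * weight W h′ ≤ 3 * weight W h
          decay = +-cancelʳ-≤ (weight W h) _ _ (begin
            2 * weight W h′ + weight W h          ≤⟨ +-monoʳ-≤ (2 * weight W h′) half ⟩
            2 * weight W h′ + 2 * weight C h      ≡⟨ *-distribˡ-+ 2 (weight W h′) _ ⟨
            2 * (weight W h′ + weight C h)        ≡⟨ cong (2 *_) doubled ⟩
            2 * (2 * weight W h)                  ≡⟨ four (weight W h) ⟩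
            3 * weight W h + weight W h           ∎)
            where
            four : ∀ x → 2 * (2 * x) ≡ 3 * x + x
            four = solve-∀
          potential′ : 2 ^ suc q * weight W h′ ≤ 3 ^ suc q * N
          potential′ = begin
            2 * 2 ^ q * weight W h′   ≡⟨ swap₁ 2 (2 ^ q) _ ⟩
            2 ^ q * (2 * weight W h′) ≤⟨ *-monoʳ-≤ (2 ^ q) decay ⟩
            2 ^ q * (3 * weight W h)  ≡⟨ swap₂ (2 ^ q) 3 _ ⟩
            3 * (2 ^ q * weight W h)  ≤⟨ *-monoʳ-≤ 3 potential ⟩
            3 * (3 ^ q * N)           ≡⟨ *-assoc 3 (3 ^ q) N ⟨
            3 * 3 ^ q * N             ∎
            where
            swap₁ : ∀ x y z → x * y * z ≡ y * (x * z)
            swap₁ = solve-∀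
            swap₂ : ∀ x y z → x * (y * z) ≡ y * (x * z)
            swap₂ = solve-∀

        -- A vertex with `nbhd c v` equal to s has weight at least 2^(q-s), and no single weight
        -- exceeds the total, which is at most (3/2)^q N. If s were below q/5, this would force 2^q
        -- ≤ N^5.
        fractionalKernel : ∀ q → N ^ 5 < 2 ^ q → FractionalKernel W a q
        fractionalKernel q N⁵<2^q = record
          { c = c ; support = support ; total = total
          ; dominated = λ v Wv → ≮⇒≥ λ 5s<q → <⇒≱ N⁵<2^q (bound v Wv (<⇒≤ 5s<q)) }
          where
          open Rounds (rounds q)
          open ≤-Reasoning
          ^-comm : ∀ x d e → (x ^ d) ^ e ≡ (x ^ e) ^ d
          ^-comm x d e = trans (^-*-assoc x d e) (trans (cong (x ^_) (*-comm d e)) (sym (^-*-assoc x e d)))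
          module _ (v : Fin N) (Wv : T (W v)) where
            s = nbhd c v
            four : 4 ^ q ≤ 3 ^ q * N * 2 ^ s
            four = begin
              4 ^ q                        ≡⟨ ^-distribʳ-* 2 2 q ⟩
              2 ^ q * 2 ^ q                ≤⟨ *-monoʳ-≤ (2 ^ q) (covered v Wv) ⟩
              2 ^ q * (h v * 2 ^ s)        ≡⟨ *-assoc (2 ^ q) (h v) _ ⟨
              2 ^ q * h v * 2 ^ s          ≤⟨ *-monoˡ-≤ (2 ^ s) (*-monoʳ-≤ (2 ^ q) hv≤) ⟩
              2 ^ q * weight W h * 2 ^ s   ≤⟨ *-monoˡ-≤ (2 ^ s) potential ⟩
              3 ^ q * N * 2 ^ s            ∎
              where
              hv≤ : h v ≤ weight W h
              hv≤ = begin
                h v           ≡⟨ *-identityˡ (h v) ⟨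
                1 * h v       ≡⟨ cong (_* h v) (𝟙-true Wv) ⟨
                𝟙 (W v) * h v ≤⟨ term≤sum (λ v → 𝟙 (W v) * h v) v ⟩
                weight W h    ∎
            -- The fifth power makes the comparison 4⁵ ≥ 2 · (3⁵ · 2) available.
            bound : 5 * s ≤ q → 2 ^ q ≤ N ^ 5
            bound 5s≤q = *-cancelˡ-≤ (486 ^ q) {{m^n≢0 486 q}} (begin
              486 ^ q * 2 ^ q                 ≡⟨ ^-distribʳ-* 486 2 q ⟨
              972 ^ q                         ≤⟨ ^-monoˡ-≤ q (≤ᵇ⇒≤ 972 1024 tt) ⟩
              1024 ^ q                        ≡⟨ ^-comm 4 5 q ⟩
              (4 ^ q) ^ 5                     ≤⟨ ^-monoˡ-≤ 5 four ⟩
              (3 ^ q * N * 2 ^ s) ^ 5         ≡⟨ ^-distribʳ-* (3 ^ q * N) (2 ^ s) 5 ⟩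
              (3 ^ q * N) ^ 5 * (2 ^ s) ^ 5   ≡⟨ cong₂ _*_ (^-distribʳ-* (3 ^ q) N 5) (^-*-assoc 2 s 5) ⟩
              (3 ^ q) ^ 5 * N ^ 5 * 2 ^ (s * 5) ≤⟨ *-mono-≤ (≤-reflexive (cong (_* N ^ 5) (^-comm 3 q 5)))
                                                   (^-monoʳ-≤ 2 (≤-trans (≤-reflexive (*-comm s 5)) 5s≤q)) ⟩
              243 ^ q * N ^ 5 * 2 ^ q         ≡⟨ swap (243 ^ q) (N ^ 5) (2 ^ q) ⟩
              243 ^ q * 2 ^ q * N ^ 5         ≡⟨ cong (_* N ^ 5) (^-distribʳ-* 243 2 q) ⟨
              486 ^ q * N ^ 5                 ∎)
              where
              swap : ∀ x y z → x * y * z ≡ x * z * y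
              swap = solve-∀

-- Building a tree one vertex at a time.

unique⇒lookup-injective : ∀ {A : Set} {xs : List A} → Unique xs → Injective _≡_ _≡_ (lookup xs)
unique⇒lookup-injective (x∉ ∷ u) {zero}  {zero}  _  = refl
unique⇒lookup-injective (x∉ ∷ u) {zero}  {suc j} eq = contradiction eq (All.lookup x∉ (∈-lookup j))
unique⇒lookup-injective (x∉ ∷ u) {suc i} {zero}  eq = contradiction (sym eq) (All.lookup x∉ (∈-lookup i))
unique⇒lookup-injective (x∉ ∷ u) {suc i} {suc j} eq = cong suc (unique⇒lookup-injective u eq)

unique⇒length≤ : ∀ {n} {xs : List (Fin n)} → Unique xs → length xs ≤ n
unique⇒length≤ u = injective⇒≤ (unique⇒lookup-injective u)

module _ {n : ℕ} (_~_ : Rel (Fin n) 0ℓ) (~-sym : Symmetric _~_) where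

  open DecMembership (_≟_ {n}) using (_∈?_)

  -- The list holds the vertices of the path after the first one.
  data Path : Fin n → Fin n → List (Fin n) → Set where
    []  : ∀ {x} → Path x x []
    _∷_ : ∀ {x y z us} → x ~ y → Path y z us → Path x z (y ∷ us)

  snoc : ∀ {x y z us} → Path x y us → y ~ z → Path x z (us ++ [ z ])
  snoc []      y~z = y~z ∷ []
  snoc (e ∷ p) y~z = e ∷ snoc p y~z

  path-step : ∀ {x y us} → Path x y us → ∀ (i : Fin (length us)) →
              lookup (x ∷ us) (inject₁ i) ~ lookup (x ∷ us) (suc i)
  path-step (e ∷ p) zero    = e
  path-step (e ∷ p) (suc i) = path-step p i

  path-end : ∀ {x y us} → Path x y us → lookup (x ∷ us) (fromℕ (length us)) ≡ y
  path-end []      = refl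
  path-end (e ∷ p) = path-end p

  -- The edges from `t` to both ends close the path up. Distinct ends make `us` nonempty, so the
  -- result has the three vertices that a `Cycle` requires.
  path⇒cycle : ∀ {t x y us} → Path x y us → Unique (t ∷ x ∷ us) →
               t ~ x → y ~ t → x ≢ y → Cycle _~_
  path⇒cycle []                u t~x y~t x≢y = contradiction refl x≢y
  path⇒cycle {t} {x} {y} {us} p@(_ ∷ _) u t~x y~t x≢y = record
    { vertex   = lookup (t ∷ x ∷ us)
    ; distinct = unique⇒lookup-injective u
    ; step     = path-step (t~x ∷ p)
    ; close    = subst (_~ t) (sym (path-end (t~x ∷ p))) y~t
    }

  SimplePathIn : List (Fin n) → Fin n → Fin n → Set
  SimplePathIn ts x y = ∃ λ us → Path x y us × Unique (x ∷ us) × All (_∈ ts) (x ∷ us)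

  -- An order of construction, newest vertex first. Each new vertex has exactly one neighbour among
  -- the older ones, so an embedding that follows this order has one edge to respect at each step.
  data Growth : List (Fin n) → Set where
    root : ∀ r → Growth (r ∷ [])
    grow : ∀ {t s ts} → Growth ts → s ∈ ts → t ∉ ts → t ~ s →
           (∀ {s′} → s′ ∈ ts → t ~ s′ → s′ ≡ s) → Growth (t ∷ ts)

  growth-unique : ∀ {ts} → Growth ts → Unique ts
  growth-unique (root r)           = [] ∷ []
  growth-unique (grow g _ t∉ts _ _) = ¬Any⇒All¬ _ t∉ts ∷ growth-unique g

  -- A path from or to the newest vertex uses its edge to `s`; the remainder stays among older
  -- vertices and cannot meet it again. These paths supply the cycles in `extend`.
  growth-path : ∀ {ts} → Growth ts → ∀ {x y} → x ∈ ts → y ∈ ts → SimplePathIn ts x y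
  growth-path (root r) (here refl) (here refl) = [] , [] , [] ∷ [] , here refl ∷ []
  growth-path (grow g s∈ t∉ t~s _) (here refl) (here refl) = [] , [] , [] ∷ [] , here refl ∷ []
  growth-path (grow {t} g s∈ t∉ t~s _) (here refl) (there y∈) =
    let us , p , u , in-ts = growth-path g s∈ y∈
    in _ , t~s ∷ p , All.map (λ z∈ t≡z → t∉ (subst (_∈ _) (sym t≡z) z∈)) in-ts ∷ u ,
       here refl ∷ All.map there in-ts
  growth-path (grow {t} g s∈ t∉ t~s _) {x} (there x∈) (here refl) =
    let us , p , u , in-ts = growth-path g x∈ s∈
    in us ++ [ t ] , snoc p (~-sym t~s) ,
       ++⁺ u ([] ∷ []) (λ { (z∈ , here refl) → t∉ (All.lookup in-ts z∈) }) ,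
       All.tabulate (λ z∈ → [ (λ q → there (All.lookup in-ts q)) , (λ { (here refl) → here refl }) ]′
         (∈-++⁻ (x ∷ us) z∈))
  growth-path (grow g s∈ t∉ t~s _) (there x∈) (there y∈) =
    let us , p , u , in-ts = growth-path g x∈ y∈
    in us , p , u , All.map there in-ts

  -- The edge sought is the first one along the walk that leaves `ts`.
  boundary : ∀ {ts x y} → Star _~_ x y → x ∈ ts → y ∉ ts → ∃₂ λ s t → s ∈ ts × t ∉ ts × t ~ s
  boundary ε x∈ y∉ = contradiction x∈ y∉
  boundary {ts} (_◅_ {i = x} {j = z} x~z walk) x∈ y∉ with z ∈? ts
  ... | yes z∈ = boundary walk z∈ y∉
  ... | no  z∉ = x , z , x∈ , z∉ , ~-sym x~z

  growth-root : ∀ {ts} → Growth ts → ∃ (_∈ ts)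
  growth-root (root r)         = r , here refl
  growth-root (grow g _ _ _ _) = _ , here refl

  module _ (connected : Connected _~_) (acyclic : ¬ Cycle _~_) where

    -- Connectedness gives an edge leaving `ts`. If its outer end `t` had two neighbours in `ts`, a
    -- simple path between them inside `ts` would close up through `t` to a cycle.
    extend : ∀ {ts v} → Growth ts → v ∉ ts → ∃ λ t → Growth (t ∷ ts)
    extend {ts} {v} g v∉ts =
      let r , r∈ = growth-root g
          s , t , s∈ , t∉ , t~s = boundary (connected r v) r∈ v∉ts
      in t , grow g s∈ t∉ t~s λ {s′} s′∈ t~s′ → parent-unique s∈ t∉ t~s s′∈ t~s′
      where
      parent-unique : ∀ {s t s′} → s ∈ ts → t ∉ ts → t ~ s → s′ ∈ ts → t ~ s′ → s′ ≡ s
      parent-unique {s} {t} {s′} s∈ t∉ t~s s′∈ t~s′ with s′ ≟ s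
      ... | yes eq = eq
      ... | no s′≢s =
        let us , p , u , in-ts = growth-path g s′∈ s∈
        in contradiction (path⇒cycle p
             (All.map (λ z∈ t≡z → t∉ (subst (_∈ ts) (sym t≡z) z∈)) in-ts ∷ u)
             t~s′ (~-sym t~s) s′≢s) acyclic

    growFully : Fin n → ∃ λ ts → Growth ts × (∀ v → v ∈ ts)
    growFully r = loop n (root r) (≤-reflexive (+-comm 1 n))
      where
      -- Exhausted fuel would leave a list of more than `n` distinct vertices.
      loop : ∀ f {ts} → Growth ts → suc n ≤ f + length ts → ∃ λ ts → Growth ts × (∀ v → v ∈ ts)
      loop f {ts} g n<f+|ts| with any? (λ v → ¬? (v ∈? ts))
      ... | no all-in = ts , g , λ v → decidable-stable (v ∈? ts) λ v∉ → all-in (v , v∉)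
      loop zero    g n<|ts|   | yes _ = contradiction (unique⇒length≤ (growth-unique g)) (<⇒≱ n<|ts|)
      loop (suc f) {ts} g n<f+|ts| | yes (v , v∉) =
        let t , g′ = extend g v∉
        in loop f g′ (≤-trans n<f+|ts| (≤-reflexive (sym (+-suc f (length ts)))))

-- Kernel weight on the vertices already used.

module _ {X : Set} {N : ℕ} where

  load : (Fin N → ℕ) → List (X × Fin N) → ℕ
  load f []             = 0
  load f ((_ , u) ∷ ps) = f u + load f ps

  load-+ : ∀ f g ps → load (λ v → f v + g v) ps ≡ load f ps + load g ps
  load-+ f g []             = refl
  load-+ f g ((_ , u) ∷ ps) rewrite load-+ f g ps = shuffle (f u) (g u) (load f ps) (load g ps)
    where
    shuffle : ∀ a b c d → a + b + (c + d) ≡ a + c + (b + d)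
    shuffle = solve-∀

  load-mono : ∀ {f g} → (∀ v → f v ≤ g v) → ∀ ps → load f ps ≤ load g ps
  load-mono f≤g []             = z≤n
  load-mono f≤g ((_ , u) ∷ ps) = +-mono-≤ (f≤g u) (load-mono f≤g ps)

zeroAt : ∀ {N} → Fin N → (Fin N → ℕ) → Fin N → ℕ
zeroAt x f u = if does (x ≟ u) then 0 else f u

sum-zeroAt : ∀ {N} (x : Fin N) f → sum f ≡ f x + sum (zeroAt x f)
sum-zeroAt zero    f = refl
sum-zeroAt (suc x) f = begin
  f zero + sum (f ∘ suc)                                    ≡⟨ cong (f zero +_) (sum-zeroAt x (f ∘ suc)) ⟩
  f zero + (f (suc x) + sum (zeroAt x (f ∘ suc)))           ≡⟨ swap (f zero) (f (suc x)) _ ⟩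
  f (suc x) + (f zero + sum (zeroAt x (f ∘ suc)))           ∎
  where
  open ≡-Reasoning
  swap : ∀ a b c → a + (b + c) ≡ b + (a + c)
  swap = solve-∀

zeroAt-≤ : ∀ {N} (x : Fin N) f u → zeroAt x f u ≤ f u
zeroAt-≤ x f u with does (x ≟ u)
... | true  = z≤n
... | false = ≤-refl

-- Splitting off the value at the head and zeroing `f` there leaves a function supported on the
-- tail. Repeated entries only increase the load.
sum≤load : ∀ {X : Set} {N} (f : Fin N → ℕ) (ps : List (X × Fin N)) →
           (∀ u → 0 < f u → u ∈ map proj₂ ps) → sum f ≤ load f ps
sum≤load {N = N} f [] supp = ≤-reflexive (trans (sum-cong-≗ vanish) (sum-replicate-zero N))
  where
  vanish : ∀ u → f u ≡ 0
  vanish u with f u in eq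
  ... | zero  = refl
  ... | suc _ with () ← supp u (subst (0 <_) (sym eq) z<s)
sum≤load f ((x , v) ∷ ps) supp = begin
  sum f                      ≡⟨ sum-zeroAt v f ⟩
  f v + sum (zeroAt v f)     ≤⟨ +-monoʳ-≤ (f v) (sum≤load (zeroAt v f) ps supp′) ⟩
  f v + load (zeroAt v f) ps ≤⟨ +-monoʳ-≤ (f v) (load-mono (zeroAt-≤ v f) ps) ⟩
  f v + load f ps            ∎
  where
  open ≤-Reasoning
  supp′ : ∀ u → 0 < zeroAt v f u → u ∈ map proj₂ ps
  supp′ u 0<f with v ≟ u
  ... | no v≢u with supp u 0<f
  ... | here u≡v = contradiction (sym u≡v) v≢u
  ... | there u∈ = u∈

module _ {N : ℕ} where

  open DecMembership (_≟_ {N}) using (_∈?_)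

  -- Were every neighbour of `v` in `W` already used, the kernel weight near `v`, at least `q`/5,
  -- would be part of the load.
  escape : ∀ {X : Set} (R : Fin N → Fin N → Bool) {W a q} (K : FractionalKernel R W a q) →
           let open FractionalKernel K in
           ∀ {v} → T (W v) → (ps : List (X × Fin N)) → 5 * load c ps < q →
           ∃ λ u → T (R v u) × T (W u) × u ∉ map proj₂ ps
  escape R {W} K {v} Wv ps light
    with any? (λ u → T? (R v u) ×-dec (T? (W u) ×-dec ¬? (u ∈? map proj₂ ps)))
  ... | yes found = found
  ... | no  none  = contradiction (≤-trans (dominated v Wv) (*-monoʳ-≤ 5 (begin
      nbhd R c v                       ≤⟨ sum≤load (λ u → 𝟙 (R v u) * c u) ps supp ⟩
      load (λ u → 𝟙 (R v u) * c u) ps  ≤⟨ load-mono (λ u → 𝟙*≤ (R v u) (c u)) ps ⟩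
      load c ps                        ∎))) (<⇒≱ light)
    where
    open FractionalKernel K
    open ≤-Reasoning
    𝟙*≤ : ∀ b x → 𝟙 b * x ≤ x
    𝟙*≤ true  x = ≤-reflexive (+-identityʳ x)
    𝟙*≤ false x = z≤n
    supp : ∀ u → 0 < 𝟙 (R v u) * c u → u ∈ map proj₂ ps
    supp u 0<f with u ∈? map proj₂ ps
    ... | yes u∈ = u∈
    ... | no  u∉ with R v u in eq
    ... | true = contradiction
      (u , subst T (sym eq) tt , support u (subst (0 <_) (+-identityʳ (c u)) 0<f) , u∉) none

  -- Towers of fractional kernels in a digraph with small independent sets.

  module _ (E : Fin N → Fin N → Bool) (E-irrefl : ∀ v → ¬ T (E v v))
           (A : Fin N → Bool) (a : ℕ)
           (small : ∀ I → (∀ v → T (I v) → T (A v)) → (∀ u v → T (I u) → T (I v) → ¬ T (E u v)) →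
                    size I ≤ a)
           where

    R⁺ R⁻ : Fin N → Fin N → Bool
    R⁺ u v = ⌊ u ≟ v ⌋ ∨ E u v
    R⁻ u v = R⁺ v u

    R⁺-refl : ∀ v → T (R⁺ v v)
    R⁺-refl v = Equivalence.from (T-∨ {⌊ v ≟ v ⌋}) (inj₁ (fromWitness {a? = v ≟ v} refl))

    R⁺⇒E : ∀ {u v} → T (R⁺ u v) → u ≢ v → T (E u v)
    R⁺⇒E {u} {v} r u≢v with Equivalence.to (T-∨ {⌊ u ≟ v ⌋}) r
    ... | inj₁ eq = contradiction (toWitness {a? = u ≟ v} eq) u≢v
    ... | inj₂ e  = e

    E⇒R⁺ : ∀ {u v} → T (E u v) → T (R⁺ u v)
    E⇒R⁺ {u} {v} e = Equivalence.from (T-∨ {⌊ u ≟ v ⌋}) (inj₂ e)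

    -- The number of rounds behind every kernel, large enough for `N⁵<2^Q`. As kernels are scaled by
    -- `Q`, the threshold 1/5 becomes `Q`/5.
    Q : ℕ
    Q = 5 * suc N

    N⁵<2^Q : N ^ 5 < 2 ^ Q
    N⁵<2^Q = begin-strict
      N ^ 5               <⟨ ^-monoˡ-< 5 (m<2^1+m N) ⟩
      (2 ^ suc N) ^ 5     ≡⟨ ^-*-assoc 2 (suc N) 5 ⟩
      2 ^ (suc N * 5)     ≡⟨ cong (2 ^_) (*-comm (suc N) 5) ⟩
      2 ^ Q               ∎
      where
      open ≤-Reasoning
      m<2^1+m : ∀ m → m < 2 ^ suc m
      m<2^1+m zero    = s≤s z≤n
      m<2^1+m (suc m) = begin-strict
        suc m                       <⟨ s<s (m<2^1+m m) ⟩
        1 + 2 ^ suc m               ≤⟨ +-monoˡ-≤ (2 ^ suc m) (m^n>0 2 (suc m)) ⟩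
        2 ^ suc m + 2 ^ suc m       ≡⟨ cong (2 ^ suc m +_) (+-identityʳ (2 ^ suc m)) ⟨
        2 ^ suc (suc m)             ∎

    live : (Fin N → ℕ) → Fin N → Bool
    live cum v = A v ∧ (5 * cum v ≤ᵇ Q)

    live⇒A : ∀ cum {v} → T (live cum v) → T (A v)
    live⇒A cum p = proj₁ (Equivalence.to T-∧ p)

    live⇒≤ : ∀ cum {v} → T (live cum v) → 5 * cum v ≤ Q
    live⇒≤ cum {v} p = ≤ᵇ⇒≤ (5 * cum v) Q (proj₂ (Equivalence.to (T-∧ {A v}) p))

    live-antitone : ∀ {cum cum′} → (∀ v → cum v ≤ cum′ v) → ∀ {v} → T (live cum′ v) → T (live cum v)
    live-antitone {cum} {cum′} le {v} p = Equivalence.from T-∧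
      (live⇒A cum′ p , ≤⇒≤ᵇ (≤-trans (*-monoʳ-≤ 5 (le v)) (live⇒≤ cum′ p)))

    Kernel⁺ Kernel⁻ : (Fin N → ℕ) → Set
    Kernel⁺ cum = FractionalKernel R⁺ (live cum) a Q
    Kernel⁻ cum = FractionalKernel R⁻ (live cum) a Q

    kernel⁺ : ∀ cum → Kernel⁺ cum
    kernel⁺ cum = fractionalKernel R⁺ R⁺-refl
      (λ I (I⊆ , indep) → small I (λ v Iv → live⇒A cum (I⊆ v Iv))
        λ u v Iu Iv e → E-irrefl v (subst (λ x → T (E x v)) (indep u v Iu Iv (E⇒R⁺ e)) e))
      Q N⁵<2^Q

    kernel⁻ : ∀ cum → Kernel⁻ cum
    kernel⁻ cum = fractionalKernel R⁻ R⁺-refl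
      (λ I (I⊆ , indep) → small I (λ v Iv → live⇒A cum (I⊆ v Iv))
        λ u v Iu Iv e → E-irrefl v (subst (λ x → T (E x v)) (sym (indep v u Iv Iu (E⇒R⁺ e))) e))
      Q N⁵<2^Q

    mass : ∀ cum → Kernel⁺ cum → Kernel⁻ cum → Fin N → ℕ
    mass cum K⁺ K⁻ v = FractionalKernel.c K⁺ v + FractionalKernel.c K⁻ v

    -- The index `cum` is the kernel weight accumulated so far, and each stage has its kernels on
    -- the vertices live before it. By `live-antitone`, a vertex live at the top is therefore
    -- dominated in every stage below.
    data Tower : ℕ → (Fin N → ℕ) → Set where
      base  : Tower 0 (const 0)
      stage : ∀ {j cum} → Tower j cum → (K⁺ : Kernel⁺ cum) (K⁻ : Kernel⁻ cum) →
              Tower (suc j) (λ v → cum v + mass cum K⁺ K⁻ v)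

    tower : ∀ j → ∃ λ cum → Tower j cum × sum cum ≤ j * (2 * (Q * a))
    tower zero    = const 0 , base , ≤-reflexive (sum-replicate-zero N)
    tower (suc j) =
      let cum , tw , le = tower j
          K⁺ = kernel⁺ cum
          K⁻ = kernel⁻ cum
          module K⁺ = FractionalKernel K⁺
          module K⁻ = FractionalKernel K⁻
          open ≤-Reasoning
      in _ , stage tw K⁺ K⁻ , (begin
        sum (λ v → cum v + mass cum K⁺ K⁻ v)      ≡⟨ ∑-distrib-+ cum (mass cum K⁺ K⁻) ⟩
        sum cum + sum (mass cum K⁺ K⁻)            ≡⟨ cong (sum cum +_) (∑-distrib-+ K⁺.c K⁻.c) ⟩
        sum cum + (sum K⁺.c + sum K⁻.c)       ≤⟨ +-mono-≤ le (+-mono-≤ K⁺.total K⁻.total) ⟩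
        j * (2 * (Q * a)) + (Q * a + Q * a)   ≡⟨ lem j (Q * a) ⟩
        suc j * (2 * (Q * a))                 ∎)
      where
      lem : ∀ j x → j * (2 * x) + (x + x) ≡ (1 + j) * (2 * x)
      lem = solve-∀

    -- Markov's inequality: each discarded vertex of `A` carries more than `Q`/5 of the accumulated
    -- weight.
    size-live : ∀ cum → Q * size A ≤ Q * size (live cum) + 5 * sum cum
    size-live cum = begin
      Q * size A                                        ≡⟨ *-distribˡ-sum Q (λ v → 𝟙 (A v) * 1) ⟩
      sum (λ v → Q * (𝟙 (A v) * 1))                     ≤⟨ sum-mono-≤ pointwise ⟩
      sum (λ v → Q * (𝟙 (live cum v) * 1) + 5 * cum v)
        ≡⟨ ∑-distrib-+ (λ v → Q * (𝟙 (live cum v) * 1)) _ ⟩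
      sum (λ v → Q * (𝟙 (live cum v) * 1)) + sum (λ v → 5 * cum v)
        ≡⟨ cong₂ _+_ (sym (*-distribˡ-sum Q (λ v → 𝟙 (live cum v) * 1))) (sym (*-distribˡ-sum 5 cum)) ⟩
      Q * size (live cum) + 5 * sum cum                 ∎
      where
      open ≤-Reasoning
      pointwise : ∀ v → Q * (𝟙 (A v) * 1) ≤ Q * (𝟙 (live cum v) * 1) + 5 * cum v
      pointwise v with A v | 5 * cum v ≤ᵇ Q in eq
      ... | false | _     = ≤-trans (≤-reflexive (*-zeroʳ Q)) z≤n
      ... | true  | true  = m≤m+n _ _
      ... | true  | false = begin
        Q * 1              ≡⟨ *-identityʳ Q ⟩
        Q                  ≤⟨ ≰⇒≥ (λ le → subst T eq (≤⇒≤ᵇ le)) ⟩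
        5 * cum v          ≤⟨ m≤n+m (5 * cum v) (Q * 0) ⟩
        Q * 0 + 5 * cum v  ∎

    size>0⇒∃ : ∀ (W : Fin N → Bool) → 0 < size W → ∃ λ v → T (W v)
    size>0⇒∃ W 0<W with any? (T? ∘ W)
    ... | yes found = found
    ... | no  none  = contradiction (size-∅ W λ v Wv → none (v , Wv)) (m<n⇒n≢0 0<W)

    -- Each stage adds two kernels of total at most `Q * a`, so by `size-live` the `j` stages
    -- discard at most 5 · 2 · `j * a` vertices.
    live-nonempty : ∀ j {cum} → sum cum ≤ j * (2 * (Q * a)) → 10 * j * a < size A →
                    ∃ λ v → T (live cum v)
    live-nonempty j {cum} le lt = size>0⇒∃ (live cum)
      (*-cancelˡ-< Q 0 (size (live cum)) (+-cancelʳ-< (Q * (10 * j * a)) (Q * 0) (Q * size (live cum)) (begin-strict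
        Q * 0 + Q * (10 * j * a)                  ≡⟨ cong (_+ Q * (10 * j * a)) (*-zeroʳ Q) ⟩
        Q * (10 * j * a)                          <⟨ *-monoʳ-< Q lt ⟩
        Q * size A                                ≤⟨ size-live cum ⟩
        Q * size (live cum) + 5 * sum cum         ≤⟨ +-monoʳ-≤ (Q * size (live cum)) (*-monoʳ-≤ 5 le) ⟩
        Q * size (live cum) + 5 * (j * (2 * (Q * a))) ≡⟨ cong (Q * size (live cum) +_) (lem Q j a) ⟩
        Q * size (live cum) + Q * (10 * j * a)    ∎)))
      where
      open ≤-Reasoning
      lem : ∀ q j a → 5 * (j * (2 * (q * a))) ≡ q * (10 * j * a)
      lem = solve-∀

    -- Embedding the tree down the tower.

    module _ {n : ℕ} (H : OrientedGraph n) where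
      open OrientedGraph H using (_⟶_; irrefl; asym)

      infix 4 _~_
      _~_ = SymClosure _⟶_

      record PartialCopy (ts : List (Fin n)) (cum : Fin N → ℕ) : Set where
        field
          pairs      : List (Fin n × Fin N)
          domain     : map proj₁ pairs ≡ ts
          alive      : ∀ {t u} → (t , u) ∈ pairs → T (live cum u)
          functional : ∀ {t u u′} → (t , u) ∈ pairs → (t , u′) ∈ pairs → u ≡ u′
          injective  : ∀ {t t′ u} → (t , u) ∈ pairs → (t′ , u) ∈ pairs → t ≡ t′
          edge       : ∀ {t t′ u u′} → (t , u) ∈ pairs → (t′ , u′) ∈ pairs → t ⟶ t′ → T (E u u′)

      module _ (m : ℕ) where

        record Placed (ts : List (Fin n)) : Set where
          field
            {j}    : ℕ
            {cum}  : Fin N → ℕ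
            stages : Tower j cum
            copy   : PartialCopy ts cum
          open PartialCopy copy public
          field
            -- The m − j stages spent so far number at most two per placed vertex
            -- plus those that were skipped; a skipped stage pays with its load.
            budget : m * Q + 5 * load cum pairs ≤ (j + 2 * length ts) * Q

        place-root : ∀ {cum v} r → Tower m cum → T (live cum v) → Placed (r ∷ [])
        place-root {cum} {v} r tw lv = record
          { stages = tw
          ; copy = record
            { pairs = (r , v) ∷ [] ; domain = refl
            ; alive = λ { (here refl) → lv }
            ; functional = λ { (here refl) (here refl) → refl }
            ; injective = λ { (here refl) (here refl) → refl }
            ; edge = λ { (here refl) (here refl) r⟶r → contradiction r⟶r (irrefl refl) }
            }
          ; budget = begin
              m * Q + 5 * (cum v + 0) ≡⟨ cong (λ x → m * Q + 5 * x) (+-identityʳ (cum v)) ⟩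
              m * Q + 5 * cum v       ≤⟨ +-monoʳ-≤ (m * Q) (live⇒≤ cum lv) ⟩
              -- The root uses one unit of its allowance of two, for its load; it takes up no stage.
              m * Q + Q               ≤⟨ m≤m+n (m * Q + Q) Q ⟩
              m * Q + Q + Q           ≡⟨ lem m Q ⟩
              (m + 2) * Q             ∎
          }
          where
          open ≤-Reasoning
          lem : ∀ m q → m * q + q + q ≡ (m + 2) * q
          lem = solve-∀

        module _ {t s ts} (s∈ : s ∈ ts) (t∉ : t ∉ ts) (t~s : t ~ s)
                 (only-s : ∀ {s′} → s′ ∈ ts → t ~ s′ → s′ ≡ s) where

          -- By `only-s`, the edge between `t` and `s` is the only one to check, and `functional`
          -- identifies the image of `s` with `v`.
          add : ∀ {cum v u} (φ : PartialCopy ts cum) → let open PartialCopy φ in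
                (s , v) ∈ pairs → T (live cum u) → u ∉ map proj₂ pairs →
                (t ⟶ s → T (E u v)) → (s ⟶ t → T (E v u)) → PartialCopy (t ∷ ts) cum
          add {cum} {v} {u} φ sv∈ lu u∉ out inn = record
            { pairs = (t , u) ∷ pairs ; domain = cong (t ∷_) domain
            ; alive = λ { (here refl) → lu ; (there p) → alive p }
            ; functional = λ
              { (here refl) (here refl) → refl
              ; (here refl) (there q)   → contradiction (fresh₁ q) t∉
              ; (there p)   (here refl) → contradiction (fresh₁ p) t∉
              ; (there p)   (there q)   → functional p q }
            ; injective = λ
              { (here refl) (here refl) → refl
              ; (here refl) (there q)   → contradiction (∈-map⁺ proj₂ q) u∉
              ; (there p)   (here refl) → contradiction (∈-map⁺ proj₂ p) u∉
              ; (there p)   (there q)   → injective p q }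
            ; edge = edge′
            }
            where
            open PartialCopy φ
            fresh₁ : ∀ {t u} → (t , u) ∈ pairs → t ∈ ts
            fresh₁ p = subst (_ ∈_) domain (∈-map⁺ proj₁ p)
            edge′ : ∀ {x x′ y y′} → (x , y) ∈ (t , u) ∷ pairs → (x′ , y′) ∈ (t , u) ∷ pairs →
                    x ⟶ x′ → T (E y y′)
            edge′ (here refl) (here refl) e = contradiction e (irrefl refl)
            edge′ (there p)   (there q)   e = edge p q e
            edge′ (here refl) (there q)   e with refl ← only-s (fresh₁ q) (fwd e)
              with refl ← functional q sv∈ = out e
            edge′ (there p)   (here refl) e with refl ← only-s (fresh₁ p) (bwd e)
              with refl ← functional p sv∈ = inn e

          -- Go down the tower, skipping stages that are heavy on the used vertices, until a light
          -- one offers a fresh neighbour. At `base` the budget would give `m` ≤ `2 * length ts`,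
          -- against `room`.
          place : 2 * length ts < m → Placed ts → Placed (t ∷ ts)
          place room P = go (Placed.stages P) (Placed.copy P) (Placed.budget P)
            where
            go : ∀ {j cum} → Tower j cum → (φ : PartialCopy ts cum) →
                 m * Q + 5 * load cum (PartialCopy.pairs φ) ≤ (j + 2 * length ts) * Q → Placed (t ∷ ts)
            go base φ b = contradiction (≤-trans (m≤m+n (m * Q) _) b)
                            (<⇒≱ (*-monoˡ-< Q room))
            go (stage {j} {cum} tw K⁺ K⁻) φ b = decide
              where
              open PartialCopy φ
              open ≤-Reasoning
              d : Fin N → ℕ
              d = mass cum K⁺ K⁻
              L = length ts
              cum≤ : ∀ v → cum v ≤ cum v + d v
              cum≤ v = m≤m+n (cum v) (d v)
              alive′ : ∀ {t u} → (t , u) ∈ pairs → T (live cum u)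
              alive′ p = live-antitone cum≤ (alive p)
              older : PartialCopy ts cum
              older = record { pairs = pairs ; domain = domain ; alive = alive′
                             ; functional = functional ; injective = injective ; edge = edge }
              -- Dropping a heavy stage lowers the left side by at least `Q`, matching the loss of
              -- one stage on the right.
              skip : Q ≤ 5 * load d pairs → m * Q + 5 * load cum pairs ≤ (j + 2 * L) * Q
              skip heavy = +-cancelʳ-≤ Q _ _ (begin
                m * Q + 5 * load cum pairs + Q                    ≤⟨ +-monoʳ-≤ (m * Q + 5 * load cum pairs) heavy ⟩
                m * Q + 5 * load cum pairs + 5 * load d pairs     ≡⟨ lem₁ (m * Q) (load cum pairs) (load d pairs) ⟩
                m * Q + 5 * (load cum pairs + load d pairs)       ≡⟨ cong (λ x → m * Q + 5 * x) (load-+ cum d pairs) ⟨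
                m * Q + 5 * load (λ v → cum v + d v) pairs        ≤⟨ b ⟩
                (suc j + 2 * L) * Q                               ≡⟨ +-comm Q _ ⟩
                (j + 2 * L) * Q + Q                               ∎)
                where
                lem₁ : ∀ x y z → x + 5 * y + 5 * z ≡ x + 5 * (y + z)
                lem₁ = solve-∀
              -- The two units brought by the new vertex pay for the stage it takes up and for its
              -- own load in the stages below, at most `Q` because it is live there.
              advance : ∀ {u} → T (live cum u) →
                        m * Q + 5 * (cum u + load cum pairs) ≤ (j + 2 * suc L) * Q
              advance {u} lu = begin
                m * Q + 5 * (cum u + load cum pairs)            ≡⟨ lem₂ (m * Q) (cum u) (load cum pairs) ⟩
                m * Q + 5 * load cum pairs + 5 * cum u
                  ≤⟨ +-mono-≤ (+-monoʳ-≤ (m * Q) (*-monoʳ-≤ 5 (load-mono cum≤ pairs))) (live⇒≤ cum lu) ⟩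
                m * Q + 5 * load (λ v → cum v + d v) pairs + Q  ≤⟨ +-monoˡ-≤ Q b ⟩
                (suc j + 2 * L) * Q + Q                         ≡⟨ lem₃ j L Q ⟩
                (j + 2 * suc L) * Q                             ∎
                where
                lem₂ : ∀ x y z → x + 5 * (y + z) ≡ x + 5 * z + 5 * y
                lem₂ = solve-∀
                lem₃ : ∀ j l q → (1 + j + 2 * l) * q + q ≡ (j + 2 * (1 + l)) * q
                lem₃ = solve-∀
              parent : ∃ λ v → (s , v) ∈ pairs
              parent with ∈-map⁻ proj₁ (subst (s ∈_) (sym domain) s∈)
              ... | (_ , v) , sv∈ , refl = v , sv∈
              v = proj₁ parent
              sv∈ = proj₂ parent
              -- Rules out the diagonal of `R⁺` and `R⁻`, so that the relation found by `escape` is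
              -- a genuine edge of `E`.
              fresh : ∀ {u} → u ∉ map proj₂ pairs → v ≢ u
              fresh u∉ refl = u∉ (∈-map⁺ proj₂ sv∈)
              module _ (light : ¬ (Q ≤ 5 * load d pairs)) where
                light⁺ : 5 * load (FractionalKernel.c K⁺) pairs < Q
                light⁺ = ≤-<-trans (*-monoʳ-≤ 5 (load-mono (λ v → m≤m+n _ _) pairs)) (≰⇒> light)
                light⁻ : 5 * load (FractionalKernel.c K⁻) pairs < Q
                light⁻ = ≤-<-trans (*-monoʳ-≤ 5 (load-mono (λ v → m≤n+m _ _) pairs)) (≰⇒> light)
                attach : t ~ s → Placed (t ∷ ts)
                attach (fwd t⟶s) =
                  -- The edge goes from `t` to `s`, so the image of `t` must be an in-neighbour of
                  -- `v`; the other orientation uses `K⁺`.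
                  let u , r , lu , u∉ = escape R⁻ K⁻ (alive′ sv∈) pairs light⁻
                  in record
                    { stages = tw
                    ; copy = add older sv∈ lu u∉ (λ _ → R⁺⇒E r (fresh u∉ ∘ sym))
                               (λ s⟶t → contradiction s⟶t (asym t⟶s))
                    ; budget = advance lu }
                attach (bwd s⟶t) =
                  let u , r , lu , u∉ = escape R⁺ K⁺ (alive′ sv∈) pairs light⁺
                  in record
                    { stages = tw
                    ; copy = add older sv∈ lu u∉ (λ t⟶s → contradiction s⟶t (asym t⟶s))
                               (λ _ → R⁺⇒E r (fresh u∉))
                    ; budget = advance lu }
              decide : Placed (t ∷ ts)
              decide with Q ≤? 5 * load d pairs
              ... | yes heavy = go tw older (skip heavy)
              ... | no  light = attach light t~s

        place-all : ∀ {cum v ts} → Tower m cum → T (live cum v) →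
                    Growth _~_ (symmetric _⟶_) ts → 2 * length ts ≤ m → Placed ts
        place-all tw lv (root r) _ = place-root r tw lv
        place-all tw lv (grow {ts = ts} g s∈ t∉ t~s only-s) le =
          place s∈ t∉ t~s only-s room (place-all tw lv g (<⇒≤ room))
          where
          room : 2 * length ts < m
          room = ≤-trans (*-monoʳ-< 2 (n<1+n (length ts))) le

    -- At two units per tree vertex, `2 * n` stages suffice, and the size hypothesis leaves a vertex
    -- live after all of them to receive the root.
    treeEmbedding : ∀ {n} (H : OrientedTree n) → let open OrientedTree H in
      10 * (2 * n) * a < size A →
      ∃ λ (φ : Fin n → Fin N) → Injective _≡_ _≡_ φ × (∀ u v → u ⟶ v → T (E (φ u) (φ v)))
    treeEmbedding {n} H large =
      let ts , g , all∈ = growFully _~′_ (symmetric _⟶_) connected acyclic (fromNonZero nonEmpty)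
          cum , tw , le = tower (2 * n)
          v , lv        = live-nonempty (2 * n) le large
          P             = place-all graph (2 * n) tw lv g
                            (*-monoʳ-≤ 2 (unique⇒length≤ (growth-unique _~′_ (symmetric _⟶_) g)))
          open Placed P
          image : ∀ t → ∃ λ u → (t , u) ∈ pairs
          image t = lookup-pair (subst (t ∈_) (sym domain) (all∈ t))
      in proj₁ ∘ image ,
         (λ {x} {y} eq → injective (proj₂ (image x)) (subst (λ u → (y , u) ∈ pairs) (sym eq) (proj₂ (image y)))) ,
         (λ x y → edge (proj₂ (image x)) (proj₂ (image y)))
      where
      open OrientedTree H
      open IsTree isTree
      _~′_ = SymClosure _⟶_
      fromNonZero : ∀ {n} → NonZero n → Fin n
      fromNonZero {suc n} _ = zero
      lookup-pair : ∀ {t} {ps : List (Fin n × Fin N)} → t ∈ map proj₁ ps → ∃ λ u → (t , u) ∈ ps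
      lookup-pair t∈ with ∈-map⁻ proj₁ t∈
      ... | (_ , u) , p , refl = u , p

-- Least witnesses and decidable conditions on coloured tournaments.

least : ∀ {P : ℕ → Set} → Decidable P → ∀ n → P n → ∃ λ r → IsLeast P r × r ≤ n
least P? zero p = 0 , (p , λ _ _ → z≤n) , z≤n
least {P} P? (suc n) p with P? 0
... | yes p₀ = 0 , (p₀ , λ _ _ → z≤n) , z≤n
... | no ¬p₀ =
  let r , (pr , r-least) , r≤n = least (P? ∘ suc) n p
  in suc r , (pr , λ { zero p₀ → contradiction p₀ ¬p₀ ; (suc m) pm → s≤s (r-least m pm) }) , s≤s r≤n

-- A k-coloured tournament is coded by one matrix: entry zero for no edge
-- and suc c for an edge of colour c.
record IsColouredTournament {N k} (g : Fin N → Fin N → Fin (suc k)) : Set where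
  field
    loopless : ∀ u → g u u ≡ zero
    oriented : ∀ u v → g u v ≡ zero ⊎ g v u ≡ zero
    total    : ∀ u v → u ≢ v → ¬ (g u v ≡ zero × g v u ≡ zero)

isColouredTournament? : ∀ {N k} (g : Fin N → Fin N → Fin (suc k)) → Dec (IsColouredTournament g)
isColouredTournament? g = map′
  (λ (l , o , t) → record { loopless = l ; oriented = o ; total = t })
  (λ ct → let open IsColouredTournament ct in loopless , oriented , total)
  (all? (λ u → g u u ≟ zero) ×-dec
   (all? (λ u → all? λ v → (g u v ≟ zero) ⊎-dec (g v u ≟ zero)) ×-dec
    all? (λ u → all? λ v → ¬? (u ≟ v) →-dec ¬? ((g u v ≟ zero) ×-dec (g v u ≟ zero)))))

module _ {n} (H : OrientedGraph n) where
  open OrientedGraph H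

  module _ {N k} (g : Fin N → Fin N → Fin (suc k)) where

    MonoEmbedding : Fin k → (Fin n → Fin N) → Set
    MonoEmbedding c φ = (∀ x y → φ x ≡ φ y → x ≡ y) × (∀ u v → u ⟶ v → g (φ u) (φ v) ≡ suc c)

    HasMono : Set
    HasMono = ∃₂ MonoEmbedding

    -- Decoding the code of a map returns it only up to pointwise equality, so `hasMono?` needs this
    -- invariance to search through codes.
    monoEmbedding-resp : ∀ {c φ ψ} → φ ≗ ψ → MonoEmbedding c φ → MonoEmbedding c ψ
    monoEmbedding-resp φ≗ψ (inj , edge) =
      (λ x y eq → inj x y (trans (φ≗ψ x) (trans eq (sym (φ≗ψ y))))) ,
      (λ u v e → trans (cong₂ g (sym (φ≗ψ u)) (sym (φ≗ψ v))) (edge u v e))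

    hasMono? : Dec HasMono
    hasMono? = any? λ c → map′
      (λ (x , m) → finToFun x , m)
      (λ (φ , m) → funToFin φ , monoEmbedding-resp (λ x → sym (finToFun-funToFin φ x)) m)
      (any? λ x → let φ = finToFun x in
        all? (λ u → all? λ v → (φ u ≟ φ v) →-dec (u ≟ v)) ×-dec
        all? (λ u → all? λ v → T? (adjacent u v) →-dec (g (φ u) (φ v) ≟ suc c)))

-- Induction on the number of colours.

size≤1 : ∀ {N} (W : Fin N → Bool) → (∀ u v → T (W u) → T (W v) → u ≡ v) → size W ≤ 1
size≤1 {N} W unique with any? (T? ∘ W)
... | no none = ≤-trans (≤-reflexive (size-∅ W λ v Wv → none (v , Wv))) z≤n
... | yes (u , Wu) = begin
  sum f                    ≡⟨ sum-zeroAt u f ⟩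
  f u + sum (zeroAt u f)   ≤⟨ +-mono-≤ (≤-reflexive (trans (*-identityʳ _) (𝟙-true Wu))) (sum-mono-≤ pointwise) ⟩
  1 + sum {N} (const 0)    ≡⟨ cong suc (sum-replicate-zero N) ⟩
  1                        ∎
  where
  open ≤-Reasoning
  f : Fin N → ℕ
  f v = 𝟙 (W v) * 1
  pointwise : ∀ v → zeroAt u f v ≤ 0
  pointwise v with u ≟ v
  ... | yes _ = z≤n
  ... | no u≢v with W v in eq
  ... | true  = contradiction (unique u v Wu (subst T (sym eq) tt)) u≢v
  ... | false = z≤n

module _ {n N k} (H : OrientedTree n) (g : Fin N → Fin N → Fin (suc k))
         (ct : IsColouredTournament g) where
  open OrientedTree H using (graph)
  open IsColouredTournament ct

  module _ (noMono : ¬ HasMono graph g) where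

    -- Inside `W`, a set independent for the last colour sees only matrix entries up to `κ`, so it
    -- is small by induction. A larger `W` would then contain the tree in that last colour. With no
    -- colours left, two distinct vertices would have no edge between them.
    few-colours⇒small : ∀ κ → κ ≤ k → (W : Fin N → Bool) →
                        (∀ u v → T (W u) → T (W v) → toℕ (g u v) ≤ κ) → size W ≤ (20 * n) ^ κ
    few-colours⇒small zero    _   W few = size≤1 W λ u v Wu Wv →
      decidable-stable (u ≟ v) λ u≢v → total u v u≢v (uncoloured Wu Wv , uncoloured Wv Wu)
      where
      uncoloured : ∀ {u v} → T (W u) → T (W v) → g u v ≡ zero
      uncoloured Wu Wv = toℕ-injective (n≤0⇒n≡0 (few _ _ Wu Wv))
    few-colours⇒small (suc κ) κ<k W few = ≮⇒≥ λ large →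
      let φ , inj , edge = treeEmbedding E E-irrefl W ((20 * n) ^ κ) small H
                             (subst (_< size W) (sym (lem n ((20 * n) ^ κ))) large)
      in noMono (c , φ , (λ _ _ → inj) , λ u v e → toWitness (edge u v e))
      where
      lem : ∀ n a → 10 * (2 * n) * a ≡ 20 * n * a
      lem = solve-∀
      -- This colour has index `κ`, hence matrix entry `κ` + 1, the largest allowed in `W`.
      c = fromℕ< κ<k
      E : Fin N → Fin N → Bool
      E u v = ⌊ g u v ≟ suc c ⌋
      E-irrefl : ∀ v → ¬ T (E v v)
      E-irrefl v e with () ← trans (sym (loopless v)) (toWitness e)
      small : ∀ I → (∀ v → T (I v) → T (W v)) → (∀ u v → T (I u) → T (I v) → ¬ T (E u v)) →
              size I ≤ (20 * n) ^ κ
      small I I⊆W indep = few-colours⇒small κ (<⇒≤ κ<k) I λ u v Iu Iv →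
        s≤s⁻¹ (≤∧≢⇒< (few u v (I⊆W u Iu) (I⊆W v Iv)) λ eq →
          indep u v Iu Iv (fromWitness (toℕ-injective (trans eq (cong suc (sym (toℕ-fromℕ< κ<k)))))))

  -- Apply the bound for all `k` colours to the whole vertex set; decidability of `HasMono` turns
  -- the refutation into an actual copy.
  ramsey : (20 * n) ^ k < N → HasMono graph g
  ramsey large = decidable-stable (hasMono? graph g) λ noMono →
    <⇒≱ large (≤-trans (≤-reflexive (sym (sum-replicate-1 N)))
      (few-colours⇒small noMono k ≤-refl (const true) (λ u v _ _ → toℕ≤pred[n] (g u v))))

-- Deciding unavoidability, and existence of the Ramsey number.

module _ {n} (H : OrientedGraph n) (k : ℕ) where

  -- Unavoidability in terms of matrices. Being finite in number, these can be enumerated, which is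
  -- not directly possible for colourings that take edge proofs as arguments.
  Forces : ℕ → Set
  Forces N = (g : Fin N → Fin N → Fin (suc k)) → IsColouredTournament g → HasMono H g

  module _ {N : ℕ} where

    decode : Fin ((suc k ^ N) ^ N) → Fin N → Fin N → Fin (suc k)
    decode x u = finToFun (finToFun x u)

    encode : (Fin N → Fin N → Fin (suc k)) → Fin ((suc k ^ N) ^ N)
    encode g = funToFin λ u → funToFin (g u)

    decode-encode : ∀ g u v → decode (encode g) u v ≡ g u v
    decode-encode g u v = trans
      (cong (λ x → finToFun x v) (finToFun-funToFin (λ u → funToFin (g u)) u))
      (finToFun-funToFin (g u) v)

  forces? : Decidable Forces
  forces? N = map′ decoded (λ forces x → forces (decode x))
    (all? λ x → isColouredTournament? (decode {N} x) →-dec hasMono? H (decode x))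
    where
    coded : ∀ g → IsColouredTournament g → IsColouredTournament (decode {N} (encode g))
    coded g ct = record
      { loopless = λ u → trans (de u u) (loopless u)
      ; oriented = λ u v → [ inj₁ ∘ trans (de u v) , inj₂ ∘ trans (de v u) ]′ (oriented u v)
      ; total    = λ u v u≢v (p , q) → total u v u≢v (trans (sym (de u v)) p , trans (sym (de v u)) q)
      }
      where
      open IsColouredTournament ct
      de = decode-encode g
    decoded : (∀ x → IsColouredTournament (decode {N} x) → HasMono H (decode x)) → Forces N
    decoded forces g ct =
      let c , φ , inj , edge = forces (encode g) (coded g ct)
      in c , φ , inj , λ u v e → trans (sym (decode-encode g (φ u) (φ v))) (edge u v e)

  forces⇒unavoidable : ∀ {N} → Forces N → Unavoidable H k N
  forces⇒unavoidable {N} forces G colour =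
    let c , φ , inj , edge = forces g ct
        found = λ u v e → coloured (T? (adjacent (φ u) (φ v))) (edge u v e)
    in record { embed = φ ; injective = λ {x} {y} → inj x y ; edge = λ u v e → proj₁ (found u v e) } ,
       c , λ u v e → proj₂ (found u v e)
    where
    open Tournament G
    entry : ∀ {u v} → Dec (u ⟶ v) → Fin (suc k)
    entry (yes e) = suc (colour _ _ e)
    entry (no _)  = zero
    g : Fin N → Fin N → Fin (suc k)
    g u v = entry (T? (adjacent u v))
    coloured : ∀ {u v c} (d : Dec (u ⟶ v)) → entry d ≡ suc c → ∃ λ e → colour u v e ≡ c
    coloured (yes e) eq = e , suc-injective eq
    absent : ∀ {u v} (d : Dec (u ⟶ v)) → ¬ u ⟶ v → entry d ≡ zero
    absent (yes e) ¬e = contradiction e ¬e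
    absent (no _)  _  = refl
    present : ∀ {u v} (d : Dec (u ⟶ v)) → entry d ≡ zero → ¬ u ⟶ v
    present (no ¬e) _ = ¬e
    ct : IsColouredTournament g
    ct = record
      { loopless = λ u → absent (T? (adjacent u u)) (irrefl refl)
      ; oriented = λ u v → oriented (T? (adjacent u v))
      ; total    = λ u v u≢v (p , q) →
          [ present (T? (adjacent u v)) p , present (T? (adjacent v u)) q ]′ (total u≢v)
      }
      where
      oriented : ∀ {u v} (d : Dec (u ⟶ v)) → entry d ≡ zero ⊎ g v u ≡ zero
      oriented (yes e) = inj₂ (absent (T? (adjacent _ _)) (asym e))
      oriented (no _)  = inj₁ refl

  unavoidable⇒forces : ∀ {N} → Unavoidable H k N → Forces N
  unavoidable⇒forces {N} unavoidable g ct =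
    let copy , c , mono = unavoidable G (λ u v → colourOf (g u v))
        open Copy copy
    in c , embed , (λ _ _ → injective) , λ u v e → decoded (edge u v e) (mono u v e)
    where
    open IsColouredTournament ct
    isEdge : Fin (suc k) → Bool
    isEdge zero    = false
    isEdge (suc _) = true
    colourOf : ∀ i → T (isEdge i) → Fin k
    colourOf (suc c) _ = c
    decoded : ∀ {i c} (e : T (isEdge i)) → colourOf i e ≡ c → i ≡ suc c
    decoded {suc c} _ eq = cong suc eq
    edge? : ∀ i → T (isEdge i) ⊎ i ≡ zero
    edge? zero    = inj₂ refl
    edge? (suc _) = inj₁ tt
    no-edge : ∀ {i} → i ≡ zero → ¬ T (isEdge i)
    no-edge refl ()
    G : Tournament N
    G = record
      { graph = record
        { adjacent = λ u v → isEdge (g u v)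
        ; irrefl   = λ { refl → no-edge (loopless _) }
        ; asym     = λ {u} {v} e e′ → [ (λ z → no-edge z e) , (λ z → no-edge z e′) ]′ (oriented u v)
        }
      ; total = λ {u} {v} u≢v → choose u≢v (edge? (g u v)) (edge? (g v u))
      }
      where
      choose : ∀ {u v} → u ≢ v → T (isEdge (g u v)) ⊎ g u v ≡ zero → T (isEdge (g v u)) ⊎ g v u ≡ zero →
               T (isEdge (g u v)) ⊎ T (isEdge (g v u))
      choose u≢v (inj₁ e) _        = inj₁ e
      choose u≢v (inj₂ _) (inj₁ e) = inj₂ e
      choose u≢v (inj₂ p) (inj₂ q) = contradiction (p , q) (total _ _ u≢v)

  -- Lets `least` find the Ramsey number by searching below a known unavoidable size.
  unavoidable? : Decidable (Unavoidable H k)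
  unavoidable? N = map′ forces⇒unavoidable unavoidable⇒forces (forces? N)

theorem1 : ∀ (k : ℕ) → 1 ≤ k →
    ∃ λ (c : ℕ) →
    ∀ (n : ℕ) (T : OrientedTree n) →
    ∃ λ (r : ℕ) → IsRT (OrientedTree.graph T) k r × r ≤ c * n ^ k
theorem1 k _ = suc (20 ^ k) , λ n H →
  let r , r-least , r≤ = least (unavoidable? (OrientedTree.graph H) k) (suc ((20 * n) ^ k))
        (forces⇒unavoidable (OrientedTree.graph H) k λ g ct → ramsey H g ct ≤-refl)
  in r , r-least , ≤-trans r≤ (bound n (IsTree.nonEmpty (OrientedTree.isTree H)))
  where
  -- The search starts from one more than `(20 * n) ^ k`, as `ramsey` needs a strict inequality.
  -- Since a tree is nonempty, `n ^ k` is at least 1 and absorbs that extra one.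
  bound : ∀ n → NonZero n → suc ((20 * n) ^ k) ≤ suc (20 ^ k) * n ^ k
  bound n n≢0 = +-mono-≤ (m^n>0 n {{n≢0}} k) (≤-reflexive (^-distribʳ-* 20 n k))
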